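{- For every integer $r\geqslant 8$, $C(n,K_{r})=\Omega(n^{2/3})$ as $n\to\infty$.
   Context: For a graph $H$ and a positive integer $n$, $C(n,H)$ denotes the minimum integer $k$ such that there exist $n$ colorings $f_v:E(K_n)\to[k]$, one for each vertex $v\in V(K_n)$ (the colorings need not be proper), with the following property: for every copy $T$ of $H$ in $K_n$, there is a vertex $v\in V(T)$ such that $f_v$ assigns pairwise distinct colors to all edges of $E(T)$. $K_r$ is the complete graph on $r$ vertices. -}

module Defs where

open import Data.Nat using (ℕ; _≤_; _*_; _^_)
open import Data.Fin using (Fin; _<_)
open import Data.Product using (Σ; ∃; _×_; _,_)
open import Function.Definitions using (Injective)
open import Relation.Binary.PropositionalEquality using (_≡_; _≢_)

-- An edge colouring of K_n with colours [k] = Fin k, given as a symmetric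
-- function on pairs of distinct vertices (values on the diagonal are irrelevant).
EdgeColouring : ℕ → ℕ → Set
EdgeColouring n k = Fin n → Fin n → Fin k

Symmetric : ∀ {n k} → EdgeColouring n k → Set
Symmetric {n} f = (i j : Fin n) → f i j ≡ f j i

CopyOfK : ℕ → ℕ → Set
CopyOfK r n = Σ (Fin r → Fin n) (Injective _≡_ _≡_)

-- f assigns pairwise distinct colours to all edges of the copy g of K_r.
-- Each edge {g a, g b} is listed once, via a < b.
Rainbow : ∀ {r n k} → EdgeColouring n k → (Fin r → Fin n) → Set
Rainbow {r} f g =
  (a b c d : Fin r) → a < b → c < d → (a , b) ≢ (c , d) →
  f (g a) (g b) ≢ f (g c) (g d)

GoodFamily : (n r k : ℕ) → Set
GoodFamily n r k =
  Σ (Fin n → EdgeColouring n k) λ F →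
    ((v : Fin n) → Symmetric (F v)) ×
    ((T : CopyOfK r n) → let g = Σ.proj₁ T in
       ∃ λ (a : Fin r) → Rainbow (F (g a)) g)

-- C(n, K_r) ≥ m  ⇔  every k admitting a good family satisfies k ≥ m
-- (since C(n,K_r) is the minimum such k). Here we express the lower bound
-- a · C(n,K_r)^3 ≥ n^2 in that form.
CLowerBound : (n r a : ℕ) → Set
CLowerBound n r a = (k : ℕ) → GoodFamily n r k → n ^ 2 ≤ a * k ^ 3

{-# OPTIONS --safe #-}

-- Let f_v be the colourings, with k colours, and fix a set U of 2k vertices. For every
-- x outside U, the map u ↦ f_x(xu) on U has at least k collisions, so by averaging some
-- pair u ≠ v in U collides for all x in a set D of size of order n / k. In every vertex
-- set containing u and v, the colourings of all the vertices of D are then not rainbow.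
-- If k³ is small compared with n², then D spans more than 2k edges, hence some edge e of D
-- shares its f_u-colour with another edge e′ of D and its f_v-colour with another edge e″.
-- Any r vertices from D ∪ {u, v} including u, v and the endpoints of e, e′, e″ (at most
-- 8 vertices) contradict the hypothesis.
module Submission where

open import Defs
open import Data.Nat using (ℕ; _≤_; _^_; _*_; NonZero)
open import Data.Product using (∃₂; _×_)
open import Data.Empty using (⊥)
open import Data.Nat using (zero; suc; _+_; _<_; z≤n; s≤s; s≤s⁻¹; _<?_)
import Data.Nat.Properties as ℕ
open import Data.Nat.Tactic.RingSolver using (solve-∀)
open import Data.Fin as Fin using (Fin; toℕ; _↑ˡ_; _↑ʳ_; combine; remQuot; punchIn; inject≤)
import Data.Fin.Properties as Fin
open import Data.List using (List; []; _∷_; length; filter; lookup; tabulate)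
open import Data.List.Properties using (length-tabulate; length-deduplicate)
open import Data.List.Membership.Propositional using (_∈_; _∉_; find)
open import Data.List.Membership.Propositional.Properties using (∈-lookup; ∈-tabulate⁺; ∈-tabulate⁻; ∈-deduplicate⁺; ∈-deduplicate⁻)
import Data.List.Membership.DecPropositional as DecMembership
open import Data.List.Relation.Binary.Subset.Propositional using (_⊆_)
open import Data.List.Relation.Unary.All as All using (All; []; _∷_)
import Data.List.Relation.Unary.All.Properties as All
open import Data.List.Relation.Unary.AllPairs using ([]; _∷_)
open import Data.List.Relation.Unary.Any using (here; there; any?; index)
open import Data.List.Relation.Unary.Any.Properties using (lookup-index)
open import Data.List.Relation.Unary.Unique.Propositional using (Unique)
import Data.List.Relation.Unary.Unique.Propositional.Properties as Unique
import Data.List.Relation.Unary.Unique.DecPropositional.Properties as DecUnique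
open import Data.Product using (∃; _,_; proj₁; proj₂; uncurry)
open import Function using (_∘_; id)
open import Function.Definitions using (Injective)
open import Level using (Level)
open import Relation.Binary.Definitions using (DecidableEquality; tri<; tri≈; tri>)
open import Relation.Binary.PropositionalEquality using (_≡_; _≢_; refl; sym; trans; cong; cong₂; subst; subst₂)
open import Relation.Nullary using (¬_; yes; no; contradiction)
open import Relation.Nullary.Decidable using (decidable-stable; ¬?)
open import Relation.Unary using (Pred; Decidable)
open import Relation.Unary.Properties using (∁?)

open ℕ.≤-Reasoning

private
  variable
    a p : Level
    A : Set a

-- Pigeonhole principles: large fibres and collisions.

length-filter-∁ : {P : Pred A p} (P? : Decidable P) (xs : List A) →
  length (filter P? xs) + length (filter (∁? P?) xs) ≡ length xs
length-filter-∁ P? [] = refl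
length-filter-∁ P? (x ∷ xs) with P? x
... | yes _ = cong suc (length-filter-∁ P? xs)
... | no  _ = trans (ℕ.+-suc _ _) (cong suc (length-filter-∁ P? xs))

lookup-injective : {xs : List A} → Unique xs → Injective _≡_ _≡_ (lookup xs)
lookup-injective (x∉ ∷ u) {Fin.zero}  {Fin.zero}  eq = refl
lookup-injective (x∉ ∷ u) {Fin.zero}  {Fin.suc j} eq =
  contradiction eq (All.lookup x∉ (∈-lookup j))
lookup-injective (x∉ ∷ u) {Fin.suc i} {Fin.zero}  eq =
  contradiction (sym eq) (All.lookup x∉ (∈-lookup i))
lookup-injective (x∉ ∷ u) {Fin.suc i} {Fin.suc j} eq = cong Fin.suc (lookup-injective u eq)

Unique-⊆⇒length-≤ : {xs ys : List A} → Unique xs → xs ⊆ ys → length xs ≤ length ys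
Unique-⊆⇒length-≤ {xs = xs} {ys} u xs⊆ys = Fin.injective⇒≤ {f = position} λ {i} {j} eq →
  lookup-injective u (trans (lookup-position i)
    (trans (cong (lookup ys) eq) (sym (lookup-position j))))
  where
  position : Fin (length xs) → Fin (length ys)
  position i = index (xs⊆ys (∈-lookup i))
  lookup-position : ∀ i → lookup xs i ≡ lookup ys (position i)
  lookup-position i = lookup-index (xs⊆ys (∈-lookup i))

-- Induction on the number of values. If the fibre over the top value has at most `c` elements,
-- discarding it leaves more than `c * k` elements with one value fewer.
large-fibre-list : ∀ k c (f : A → ℕ) {xs} → Unique xs → All (λ x → f x < k) xs →
  c * k < length xs →
  ∃₂ λ y ys → Unique ys × All (λ x → f x ≡ y) ys × c < length ys
large-fibre-list zero c f {[]} u _ c*k< = contradiction c*k< λ ()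
large-fibre-list zero c f {_ ∷ _} u (() ∷ _) c*k<
large-fibre-list (suc k) c f {xs} u f< c*k<
  with c <? length (filter (λ x → f x ℕ.≟ k) xs)
... | yes c< = let P? = λ x → f x ℕ.≟ k in
  k , filter P? xs , Unique.filter⁺ P? u , All.all-filter P? xs , c<
... | no  c≮ = large-fibre-list k c f (Unique.filter⁺ (∁? P?) u)
  (All.zipWith (λ (f<1+k , f≢k) → ℕ.≤∧≢⇒< (s≤s⁻¹ f<1+k) f≢k)
    (All.filter⁺ (∁? P?) f< , All.all-filter (∁? P?) xs))
  (ℕ.+-cancelˡ-< c _ _ (begin-strict
    c + c * k                                               ≡⟨ ℕ.*-suc c k ⟨
    c * suc k                                               <⟨ c*k< ⟩
    length xs                                               ≡⟨ length-filter-∁ P? xs ⟨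
    length (filter P? xs) + length (filter (∁? P?) xs)      ≤⟨ ℕ.+-monoˡ-≤ _ (ℕ.≮⇒≥ c≮) ⟩
    c + length (filter (∁? P?) xs)                          ∎))
  where
  P? : Decidable (λ x → f x ≡ k)
  P? x = f x ℕ.≟ k

large-fibre : ∀ {m k} c (f : Fin m → Fin k) → c * k < m →
  ∃ λ (h : Fin (suc c) → Fin m) → Injective _≡_ _≡_ h × (∀ i j → f (h i) ≡ f (h j))
large-fibre {m} {k} c f c*k<m
  with y , ys , u , f≡y , c< ← large-fibre-list k c (toℕ ∘ f) (Unique.allFin⁺ m)
         (All.universal (Fin.toℕ<n ∘ f) _) (subst (c * k <_) (sym (length-tabulate id)) c*k<m)
  = h , (λ eq → Fin.inject≤-injective c< c< _ _ (lookup-injective u eq))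
      , λ i j → Fin.toℕ-injective (trans (fh≡y i) (sym (fh≡y j)))
  where
  h : Fin (suc c) → Fin m
  h i = lookup ys (inject≤ i c<)
  fh≡y : ∀ i → toℕ (f (h i)) ≡ y
  fh≡y i = All.lookup f≡y (∈-lookup (inject≤ i c<))

-- Apply the pigeonhole principle, delete one point of the collision found, and repeat.
many-collisions : ∀ m {k} (f : Fin (m + k) → Fin k) →
  ∃₂ λ (α β : Fin m → Fin (m + k)) →
    Injective _≡_ _≡_ α × (∀ i → α i ≢ β i) × (∀ i → f (α i) ≡ f (β i))
many-collisions zero f = (λ ()) , (λ ()) , (λ {}) , (λ ()) , (λ ())
many-collisions (suc m) {k} f
  with i , j , i<j , fi≡fj ← Fin.pigeonhole (s≤s (ℕ.m≤n+m k m)) f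
  with α , β , α-inj , α≢β , fα≡fβ ← many-collisions m (f ∘ punchIn i)
  = α′ , β′ , α′-inj , α′≢β′ , fα′≡fβ′
  where
  α′ β′ : Fin (suc m) → Fin (suc m + k)
  α′ Fin.zero    = i
  α′ (Fin.suc t) = punchIn i (α t)
  β′ Fin.zero    = j
  β′ (Fin.suc t) = punchIn i (β t)
  α′-inj : Injective _≡_ _≡_ α′
  α′-inj {Fin.zero}  {Fin.zero}  eq = refl
  α′-inj {Fin.zero}  {Fin.suc t} eq = contradiction (sym eq) (Fin.punchInᵢ≢i i (α t))
  α′-inj {Fin.suc s} {Fin.zero}  eq = contradiction eq (Fin.punchInᵢ≢i i (α s))
  α′-inj {Fin.suc s} {Fin.suc t} eq = cong Fin.suc (α-inj (Fin.punchIn-injective i _ _ eq))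
  α′≢β′ : ∀ t → α′ t ≢ β′ t
  α′≢β′ Fin.zero    = Fin.<⇒≢ i<j
  α′≢β′ (Fin.suc t) = α≢β t ∘ Fin.punchIn-injective i _ _
  fα′≡fβ′ : ∀ t → f (α′ t) ≡ f (β′ t)
  fα′≡fβ′ Fin.zero    = fi≡fj
  fα′≡fβ′ (Fin.suc t) = fα≡fβ t

-- Among `2k + 1` points, `f` has `k + 1` collisions with distinct first members `α i`. Two of these
-- first members collide under `g`, so `α i` has the `f`-partner `β i` and the `g`-partner `α j`.
common-collision : ∀ {k} (f g : Fin (suc k + k) → Fin k) →
  ∃ λ e → (∃ λ e′ → e ≢ e′ × f e ≡ f e′) × (∃ λ e′ → e ≢ e′ × g e ≡ g e′)
common-collision {k} f g
  with α , β , α-inj , α≢β , fα≡fβ ← many-collisions (suc k) f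
  with i , j , i<j , gi≡gj ← Fin.pigeonhole (ℕ.n<1+n k) (g ∘ α)
  = α i , (β i , α≢β i , fα≡fβ i) , (α j , Fin.<⇒≢ i<j ∘ α-inj , gi≡gj)

-- Each φ x has at least k collisions among the (2k)² pairs; count incidences.
popular-collision : ∀ {w k} c (φ : Fin w → Fin (k + k) → Fin k) →
  c * ((k + k) * (k + k)) < w * k →
  ∃₂ λ u v → u ≢ v × ∃ λ (δ : Fin (suc c) → Fin w) →
    Injective _≡_ _≡_ δ × (∀ i → φ (δ i) u ≡ φ (δ i) v)
popular-collision {w} {k} c φ c*< =
  u , v , subst₂ _≢_ (u≡ Fin.zero) (v≡ Fin.zero) (α≢β _ _) , δ , δ-inj ,
  λ i → subst₂ (λ s t → φ (δ i) s ≡ φ (δ i) t) (u≡ i) (v≡ i) (φα≡φβ _ _)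
  where
  α β : Fin w → Fin k → Fin (k + k)
  α x = proj₁ (many-collisions k (φ x))
  β x = proj₁ (proj₂ (many-collisions k (φ x)))
  α-inj : ∀ x → Injective _≡_ _≡_ (α x)
  α-inj x = proj₁ (proj₂ (proj₂ (many-collisions k (φ x))))
  α≢β : ∀ x j → α x j ≢ β x j
  α≢β x = proj₁ (proj₂ (proj₂ (proj₂ (many-collisions k (φ x)))))
  φα≡φβ : ∀ x j → φ x (α x j) ≡ φ x (β x j)
  φα≡φβ x = proj₂ (proj₂ (proj₂ (proj₂ (many-collisions k (φ x)))))
  pair : Fin w × Fin k → Fin ((k + k) * (k + k))
  pair (x , j) = combine (α x j) (β x j)
  fibre = large-fibre c (pair ∘ remQuot k) c*<
  h : Fin (suc c) → Fin w × Fin k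
  h i = remQuot k (proj₁ fibre i)
  δ : Fin (suc c) → Fin w
  δ = proj₁ ∘ h
  ι : Fin (suc c) → Fin k
  ι = proj₂ ∘ h
  u v : Fin (k + k)
  u = α (δ Fin.zero) (ι Fin.zero)
  v = β (δ Fin.zero) (ι Fin.zero)
  u≡ : ∀ i → α (δ i) (ι i) ≡ u
  u≡ i = Fin.combine-injectiveˡ _ _ _ _ (proj₂ (proj₂ fibre) i Fin.zero)
  v≡ : ∀ i → β (δ i) (ι i) ≡ v
  v≡ i = Fin.combine-injectiveʳ (α (δ i) (ι i)) _ u _ (proj₂ (proj₂ fibre) i Fin.zero)
  -- Each `x` occurs at most once in the fibre over `(u , v)`: since `α x` is injective, `x` and `u`
  -- determine the index of the collision.
  δ-inj : Injective _≡_ _≡_ δ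
  δ-inj {i} {j} eq = proj₁ (proj₂ fibre) (trans (sym (Fin.combine-remQuot {w} k _))
    (trans (cong₂ combine eq ι≡) (Fin.combine-remQuot {w} k _)))
    where
    ι≡ : ι i ≡ ι j
    ι≡ = α-inj (δ j) (trans (cong (λ x → α x (ι i)) (sym eq)) (trans (u≡ i) (sym (u≡ j))))

-- Completing a list to a prescribed length inside a larger one.

module _ {a} {A : Set a} (_≟_ : DecidableEquality A) where
  open DecMembership _≟_ using (_∈?_)

  fresh : {xs ys : List A} → Unique xs → length ys < length xs → ∃ λ x → x ∈ xs × x ∉ ys
  fresh {xs} {ys} u ys<xs with any? (λ x → ¬? (x ∈? ys)) xs
  ... | yes p = find p
  ... | no ¬p = contradiction ys<xs (ℕ.≤⇒≯ (Unique-⊆⇒length-≤ u λ {x} x∈xs →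
    decidable-stable (x ∈? ys) (All.lookup (All.¬Any⇒All¬ xs ¬p) x∈xs)))

  pad : ∀ {xs} → Unique xs → ∀ j {ys} → Unique ys → ys ⊆ xs → j + length ys ≤ length xs →
    ∃ λ zs → Unique zs × ys ⊆ zs × zs ⊆ xs × length zs ≡ j + length ys
  pad uxs zero uys ys⊆xs _ = _ , uys , id , ys⊆xs , refl
  pad {xs} uxs (suc j) {ys} uys ys⊆xs ≤xs
    with x , x∈xs , x∉ys ← fresh uxs (ℕ.≤-trans (s≤s (ℕ.m≤n+m _ j)) ≤xs)
    with zs , uzs , ⊆zs , zs⊆ , len ← pad uxs j {x ∷ ys}
           (All.¬Any⇒All¬ ys x∉ys ∷ uys)
           (λ { (here refl) → x∈xs ; (there y∈) → ys⊆xs y∈ })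
           (subst (_≤ length xs) (sym (ℕ.+-suc j _)) ≤xs)
    = zs , uzs , ⊆zs ∘ there , zs⊆ , trans len (ℕ.+-suc j _)

  -- The list `ps` may have repetitions, as the chosen edges can share endpoints. Duplicates are
  -- removed first, and fresh elements of `xs` then fill the gap `j` up to `r`.
  interpolate : ∀ {xs ps r} → Unique xs → ps ⊆ xs → length ps ≤ r → r ≤ length xs →
    ∃ λ zs → Unique zs × ps ⊆ zs × zs ⊆ xs × length zs ≡ r
  interpolate {xs} {ps} {r} uxs ps⊆xs ps≤r r≤xs
    with j , refl ← ℕ.m≤n⇒∃[o]m+o≡n (ℕ.≤-trans (length-deduplicate _≟_ ps) ps≤r)
    with zs , uzs , ⊆zs , zs⊆ , len ← pad uxs j (DecUnique.deduplicate-! _≟_ ps)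
           (ps⊆xs ∘ ∈-deduplicate⁻ _≟_ ps) (subst (_≤ length xs) (ℕ.+-comm _ j) r≤xs)
    = zs , uzs , ⊆zs ∘ ∈-deduplicate⁺ _≟_ , zs⊆ , trans len (ℕ.+-comm j _)

-- Repeated colours in a copy of the complete graph.

-- `Rainbow` lists edges with increasing endpoints only, so both edges are first sorted by means of
-- the symmetry of `f`. The two negated conjunctions say that they differ as unordered pairs.
repeat⇒¬Rainbow : ∀ {r n k} {f : EdgeColouring n k} {g : Fin r → Fin n} → Symmetric f →
  ∀ {a b c d} → a ≢ b → c ≢ d → ¬ (a ≡ c × b ≡ d) → ¬ (a ≡ d × b ≡ c) →
  f (g a) (g b) ≡ f (g c) (g d) → ¬ Rainbow f g
repeat⇒¬Rainbow sym-f {a} {b} {c} {d} a≢b c≢d ≢₁ ≢₂ eq rb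
  with Fin.<-cmp a b | Fin.<-cmp c d
... | tri≈ _ a≡b _ | _ = a≢b a≡b
... | _ | tri≈ _ c≡d _ = c≢d c≡d
... | tri< a<b _ _ | tri< c<d _ _ = rb a b c d a<b c<d (λ { refl → ≢₁ (refl , refl) }) eq
... | tri< a<b _ _ | tri> _ _ d<c = rb a b d c a<b d<c (λ { refl → ≢₂ (refl , refl) })
  (trans eq (sym-f _ _))
... | tri> _ _ b<a | tri< c<d _ _ = rb b a c d b<a c<d (λ { refl → ≢₂ (refl , refl) })
  (trans (sym-f _ _) eq)
... | tri> _ _ b<a | tri> _ _ d<c = rb b a d c b<a d<c (λ { refl → ≢₁ (refl , refl) })
  (trans (sym-f _ _) (trans eq (sym-f _ _)))

-- `Rainbow` compares positions in `zs`. Equal positions hold equal vertices, so inequalities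
-- between vertices pass to positions.
repeat-∈⇒¬Rainbow : ∀ {n k} {f : EdgeColouring n k} {zs : List (Fin n)} → Symmetric f →
  ∀ {p q s t} → p ∈ zs → q ∈ zs → s ∈ zs → t ∈ zs →
  p ≢ q → s ≢ t → ¬ (p ≡ s × q ≡ t) → ¬ (p ≡ t × q ≡ s) →
  f p q ≡ f s t → ¬ Rainbow f (lookup zs)
repeat-∈⇒¬Rainbow {f = f} {zs} sym-f p∈ q∈ s∈ t∈ p≢q s≢t ≢₁ ≢₂ eq =
  repeat⇒¬Rainbow sym-f
    (p≢q ∘ same p∈ q∈) (s≢t ∘ same s∈ t∈)
    (λ (e , e′) → ≢₁ (same p∈ s∈ e , same q∈ t∈ e′))
    (λ (e , e′) → ≢₂ (same p∈ t∈ e , same q∈ s∈ e′))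
    (subst₂ _≡_ (cong₂ f (lookup-index p∈) (lookup-index q∈))
                (cong₂ f (lookup-index s∈) (lookup-index t∈)) eq)
  where
  same : ∀ {x y} (x∈ : x ∈ zs) (y∈ : y ∈ zs) → index x∈ ≡ index y∈ → x ≡ y
  same x∈ y∈ eq = trans (lookup-index x∈) (trans (cong (lookup zs) eq) (sym (lookup-index y∈)))

-- The contradiction from too few colours.

↑ˡ≢↑ʳ : ∀ {m n} (i : Fin m) (j : Fin n) → i ↑ˡ n ≢ m ↑ʳ j
↑ˡ≢↑ʳ {m} {n} i j eq with trans (sym (Fin.splitAt-↑ˡ m i n))
  (trans (cong (Fin.splitAt m) eq) (Fin.splitAt-↑ʳ m n j))
... | ()

-- The popular pair is sought among the first `k + k` vertices, using the colourings of the other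
-- `w`. The density hypothesis yields `2m + 1` of the latter, enough for two disjoint halves of size
-- `m`; the `m * m` edges between the halves include the `2k + 1` required by `common-collision`.
few-colours⇒¬GoodFamily : ∀ {r k m w} → 8 ≤ r → r ≤ m → suc k + k ≤ m * m →
  (m + m) * ((k + k) * (k + k)) < w * k → ¬ GoodFamily (k + k + w) r k
few-colours⇒¬GoodFamily {r} {k} {m} {w} 8≤r r≤m 2k<m² dense (F , F-sym , good)
  with u , v , u≢v , δ , δ-inj , φu≡φv ← popular-collision (m + m)
         (λ x t → F ((k + k) ↑ʳ x) ((k + k) ↑ʳ x) (t ↑ˡ w)) dense
  = absurd
  where
  -- These are single vertices, the popular pair viewed in the whole graph.
  U V : Fin (k + k + w)
  U = u ↑ˡ w
  V = v ↑ˡ w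
  U≢V : U ≢ V
  U≢V = u≢v ∘ Fin.↑ˡ-injective w u v
  D : Fin (suc (m + m)) → Fin (k + k + w)
  D i = (k + k) ↑ʳ δ i
  D-inj : Injective _≡_ _≡_ D
  D-inj = δ-inj ∘ Fin.↑ʳ-injective (k + k) _ _
  -- Only edges between two disjoint halves of D are used, so that distinct ordered
  -- pairs are distinct as unordered edges.
  L R : Fin m → Fin (k + k + w)
  L i = D (Fin.suc (i ↑ˡ m))
  R j = D (Fin.suc (m ↑ʳ j))
  L≢R : ∀ i j → L i ≢ R j
  L≢R i j = ↑ˡ≢↑ʳ i j ∘ Fin.suc-injective ∘ D-inj
  left right : Fin (suc k + k) → Fin (k + k + w)
  left  e = L (proj₁ (remQuot m (inject≤ e 2k<m²)))
  right e = R (proj₂ (remQuot {m} m (inject≤ e 2k<m²)))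
  edge-injective : ∀ {e e′} → left e ≡ left e′ → right e ≡ right e′ → e ≡ e′
  edge-injective {e} {e′} l≡ r≡ = Fin.inject≤-injective 2k<m² 2k<m² e e′
    (trans (sym (Fin.combine-remQuot {m} m _)) (trans (cong₂ combine
      (Fin.↑ˡ-injective m _ _ (Fin.suc-injective (D-inj l≡)))
      (Fin.↑ʳ-injective m _ _ (Fin.suc-injective (D-inj r≡))))
      (Fin.combine-remQuot {m} m _)))
  xs : List (Fin (k + k + w))
  xs = U ∷ V ∷ tabulate D
  xs-unique : Unique xs
  xs-unique = (U≢V ∷ All.tabulate⁺ (λ i → ↑ˡ≢↑ʳ u (δ i)))
            ∷ All.tabulate⁺ (λ i → ↑ˡ≢↑ʳ v (δ i)) ∷ Unique.tabulate⁺ D-inj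
  D∈xs : ∀ i → D i ∈ xs
  D∈xs i = there (there (∈-tabulate⁺ {f = D} i))
  edge-repeat⇒¬Rainbow : ∀ x {zs} {e e′} → left e ∈ zs → right e ∈ zs →
    left e′ ∈ zs → right e′ ∈ zs → e ≢ e′ →
    F x (left e) (right e) ≡ F x (left e′) (right e′) → ¬ Rainbow (F x) (lookup zs)
  edge-repeat⇒¬Rainbow x l∈ r∈ l′∈ r′∈ e≢e′ = repeat-∈⇒¬Rainbow (F-sym x) l∈ r∈ l′∈ r′∈
    (L≢R _ _) (L≢R _ _) (e≢e′ ∘ uncurry edge-injective) (λ (l≡r , _) → L≢R _ _ l≡r)
  absurd : ⊥
  absurd
    with e , (e₁ , e≢e₁ , U-repeat) , (e₂ , e≢e₂ , V-repeat) ← common-collision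
           (λ e → F U (left e) (right e)) (λ e → F V (left e) (right e))
    -- The eight prescribed vertices account for the bound `8 ≤ r`. Matching `refl` turns `r` into
    -- the length of `zs`, so that `lookup zs` is a copy of the complete graph.
    with zs , zs-unique , ps⊆zs , zs⊆xs , refl ← interpolate Fin._≟_ {xs}
           {U ∷ V ∷ left e ∷ right e ∷ left e₁ ∷ right e₁ ∷ left e₂ ∷ right e₂ ∷ []} {r} xs-unique
           (All.lookup {P = _∈ xs} (here refl ∷ there (here refl) ∷
             D∈xs _ ∷ D∈xs _ ∷ D∈xs _ ∷ D∈xs _ ∷ D∈xs _ ∷ D∈xs _ ∷ []))
           8≤r (begin
             r                    ≤⟨ r≤m ⟩
             m                    ≤⟨ ℕ.m≤n+m m (3 + m) ⟩
             3 + m + m            ≡⟨ cong (2 +_) (length-tabulate D) ⟨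
             length xs            ∎)
    with i , rainbow ← good (lookup zs , lookup-injective zs-unique)
    with U∈ ∷ V∈ ∷ l∈ ∷ r∈ ∷ l₁∈ ∷ r₁∈ ∷ l₂∈ ∷ r₂∈ ∷ [] ← All.tabulate ps⊆zs
    -- The vertex with the rainbow colouring is `U`, refuted by `e` and `e₁`, or `V`, refuted by `e`
    -- and `e₂`, or some `D j`, refuted by its edges to `U` and `V`.
    with zs⊆xs (∈-lookup i)
  ... | here eq =
    edge-repeat⇒¬Rainbow U l∈ r∈ l₁∈ r₁∈ e≢e₁ U-repeat
      (subst (λ x → Rainbow (F x) (lookup zs)) eq rainbow)
  ... | there (here eq) =
    edge-repeat⇒¬Rainbow V l∈ r∈ l₂∈ r₂∈ e≢e₂ V-repeat
      (subst (λ x → Rainbow (F x) (lookup zs)) eq rainbow)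
  ... | there (there x∈D) with j , eq ← ∈-tabulate⁻ x∈D =
    repeat-∈⇒¬Rainbow (F-sym (D j)) D∈ U∈ D∈ V∈ (D≢U u) (D≢U v) (U≢V ∘ proj₂) (D≢U v ∘ proj₁)
      (φu≡φv j) (subst (λ x → Rainbow (F x) (lookup zs)) eq rainbow)
    where
    D∈ : D j ∈ zs
    D∈ = subst (_∈ zs) eq (∈-lookup i)
    D≢U : ∀ t → D j ≢ t ↑ˡ w
    D≢U t = ↑ˡ≢↑ʳ t (δ j) ∘ sym

-- Choice of parameters and the final estimate.

√-bounds : ∀ k → ∃ λ s → s * s ≤ k × k < suc s * suc s
√-bounds zero = 0 , z≤n , s≤s z≤n
√-bounds (suc k) with s , s²≤k , k<[1+s]² ← √-bounds k with suc k <? suc s * suc s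
... | yes 1+k< = s , ℕ.m≤n⇒m≤1+n s²≤k , 1+k<
... | no  1+k≮ = suc s , ℕ.≮⇒≥ 1+k≮ , ℕ.≤-<-trans k<[1+s]²
  (ℕ.*-mono-< (ℕ.n<1+n (suc s)) (ℕ.n<1+n (suc s)))

many-vertices⇒¬GoodFamily : ∀ {r n s k} .{{_ : NonZero k}} → 8 ≤ r → k < suc s * suc s →
  2 * k + 8 * (r * suc s) * k < n → ¬ GoodFamily n r k
many-vertices⇒¬GoodFamily {r} {n} {s} {k} 8≤r k<[1+s]² <n
  with w , refl ← ℕ.m≤n⇒∃[o]m+o≡n {k + k} {n} (begin
    k + k                        ≡⟨ cong (k +_) (ℕ.+-identityʳ k) ⟨
    2 * k                        ≤⟨ ℕ.m≤m+n (2 * k) _ ⟩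
    2 * k + 8 * (r * suc s) * k  ≤⟨ ℕ.<⇒≤ <n ⟩
    n                            ∎)
  -- With `w` equal to `n - 2k`, the density condition is `8 * m * k < w` multiplied by `k`.
  = few-colours⇒¬GoodFamily {m = m} {w} 8≤r (ℕ.m≤m*n r (suc s)) 2k<m² (begin-strict
    (m + m) * ((k + k) * (k + k))   ≡⟨ expand m k ⟩
    8 * m * k * k                   <⟨ ℕ.*-monoˡ-< k (ℕ.+-cancelˡ-< (k + k) _ _
      (subst (λ t → t + 8 * m * k < k + k + w) (cong (k +_) (ℕ.+-identityʳ k)) <n)) ⟩
    w * k                           ∎)
  where
  -- The factor `suc s` makes `m` of order the square root of `k`. The factor `r` ensures `r ≤ m`
  -- and, being at least 2, makes `m * m` at least four times the square of `suc s`, hence more than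
  -- `2k`.
  m : ℕ
  m = r * suc s
  expand : ∀ m k → (m + m) * ((k + k) * (k + k)) ≡ 8 * m * k * k
  expand = solve-∀
  regroup : ∀ x → 2 * x * (2 * x) ≡ x * x + (x * x + 2 * (x * x))
  regroup = solve-∀
  2k<m² : suc k + k ≤ m * m
  2k<m² = begin
    suc k + k                                    ≤⟨ ℕ.+-mono-≤ k<[1+s]² (ℕ.<⇒≤ k<[1+s]²) ⟩
    suc s * suc s + suc s * suc s                ≤⟨ ℕ.+-monoʳ-≤ (suc s * suc s) (ℕ.m≤m+n _ _) ⟩
    suc s * suc s + (suc s * suc s + 2 * (suc s * suc s)) ≡⟨ regroup (suc s) ⟨
    2 * suc s * (2 * suc s)                      ≤⟨ ℕ.*-mono-≤ 2[1+s]≤m 2[1+s]≤m ⟩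
    m * m                                        ∎
    where
    2[1+s]≤m : 2 * suc s ≤ m
    2[1+s]≤m = ℕ.*-monoˡ-≤ (suc s) (ℕ.≤-trans (s≤s (s≤s z≤n)) 8≤r)

lower-bound : ∀ r → 8 ≤ r → ∀ n → CLowerBound n r ((18 * r) ^ 2)
lower-bound r 8≤r zero k family = z≤n
-- Colourings also take values on the diagonal, so without colours none exists even on a single
-- vertex.
lower-bound r 8≤r (suc n) zero (F , _) = contradiction (F Fin.zero Fin.zero Fin.zero) λ ()
lower-bound r 8≤r n@(suc _) k@(suc _) family
  with √-bounds k
-- Since `k` is positive, so is its integer square root `s`; the estimate of `suc s` by `s + s`
-- below relies on this.
... | zero , _ , s≤s ()
... | s@(suc s′) , s²≤k , k<[1+s]²
  with 2 * k + 8 * (r * suc s) * k <? n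
... | no  ≮n = begin
  n ^ 2                                  ≤⟨ ℕ.^-monoˡ-≤ 2 (ℕ.≮⇒≥ ≮n) ⟩
  (2 * k + 8 * (r * suc s) * k) ^ 2      ≤⟨ ℕ.^-monoˡ-≤ 2 threshold ⟩
  (18 * r * s * k) ^ 2                   ≡⟨ square (18 * r) s k ⟩
  (18 * r) ^ 2 * (s * s * k ^ 2)         ≤⟨ ℕ.*-monoʳ-≤ ((18 * r) ^ 2) (ℕ.*-monoˡ-≤ (k ^ 2) s²≤k) ⟩
  (18 * r) ^ 2 * k ^ 3                   ∎
  where
  -- (x y z)² = x² y² z², with `^` unfolded since solve-∀ fails on it.
  square : ∀ x y z → x * y * z * (x * y * z * 1) ≡ x * (x * 1) * (y * y * (z * (z * 1)))
  square = solve-∀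
  expand : ∀ r s k → 2 * r * s * k + 8 * (r * (s + s)) * k ≡ 18 * r * s * k
  expand = solve-∀
  threshold : 2 * k + 8 * (r * suc s) * k ≤ 18 * r * s * k
  -- The constant 18 is 2 + 16: the first term is enlarged by the factor `r * s`, which is at least
  -- 1, and `suc s` is replaced by `s + s`.
  threshold = begin
    2 * k + 8 * (r * suc s) * k                ≤⟨ ℕ.+-mono-≤
      (ℕ.*-monoˡ-≤ k (ℕ.*-mono-≤ (ℕ.*-monoʳ-≤ 2 (ℕ.≤-trans (s≤s z≤n) 8≤r)) (s≤s (z≤n {s′}))))
      (ℕ.*-monoˡ-≤ k (ℕ.*-monoʳ-≤ 8 (ℕ.*-monoʳ-≤ r (ℕ.+-monoˡ-≤ s (s≤s (z≤n {s′})))))) ⟩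
    2 * r * s * k + 8 * (r * (s + s)) * k      ≡⟨ expand r s k ⟩
    18 * r * s * k                             ∎
... | yes <n = contradiction family (many-vertices⇒¬GoodFamily 8≤r k<[1+s]² <n)

theorem2 : (r : ℕ) → 8 ≤ r →
    ∃₂ λ (a N : ℕ) → NonZero a × ((n : ℕ) → N ≤ n → CLowerBound n r a)
theorem2 r@(suc _) 8≤r = (18 * r) ^ 2 , 0 , _ , λ n _ → lower-bound r 8≤r n
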